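{- The identities (A6) $x\wedge(y\wedge z)\approx y\wedge(z\wedge x)$, (J5') $x\approx (x'\wedge y)'\wedge(x'\wedge y')'$ form a 2-base for the variety $\mathbb{BA}$ of Boolean algebras (in the language $\langle\wedge,{}'\rangle$).
   Context: Algebras are of type $\langle \wedge, {}'\rangle$ with $\wedge$ binary and ${}'$ unary. The variety $\mathbb{BA}$ of Boolean algebras in this language consists of the algebras $\langle B,\wedge,{}'\rangle$ obtained from Boolean algebras by keeping only meet and complement (equivalently, the variety generated by the two-element Boolean algebra with meet and complement). A base for a variety is an independent set of identities (no identity in the set follows from the others) that defines the variety; an $n$-base is a base with exactly $n$ identities. -}

module Defs where

open import Level using (Level; _⊔_; suc)
open import Data.Fin using (Fin)
open import Data.Nat using (ℕ)
open import Data.Product using (_×_; ∃-syntax)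
open import Data.Vec.Functional using (Vector)
open import Function.Bundles using (_⇔_)
open import Relation.Binary.Core using (Rel)
open import Relation.Binary.PropositionalEquality using (_≢_)
open import Relation.Binary.Structures using (IsEquivalence)
open import Relation.Nullary using (¬_)
open import Algebra.Core using (Op₁; Op₂)
open import Algebra.Definitions using (Congruent₁; Congruent₂)
open import Algebra.Lattice.Structures using (IsBooleanAlgebra)

private
  variable
    c ℓ v : Level

-- Algebras of type ⟨∧,′⟩ over a setoid. As usual in universal algebra they
-- are nonempty; `inhabitant` records only this: it is not an operation, and
-- no term refers to it.
record Algebra (c ℓ : Level) : Set (suc (c ⊔ ℓ)) where
  infix  4 _≈_
  infixr 7 _∧_
  infix  8 _′
  field
    Carrier       : Set c
    _≈_           : Rel Carrier ℓ
    _∧_           : Op₂ Carrier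
    _′            : Op₁ Carrier
    inhabitant    : Carrier
    isEquivalence : IsEquivalence _≈_
    ∧-cong        : Congruent₂ _≈_ _∧_
    ′-cong        : Congruent₁ _≈_ _′

infixr 7 _∧_
infix  8 _′

data Term : Set where
  var : ℕ → Term
  _∧_ : Term → Term → Term
  _′  : Term → Term

infix 4 _≈_

record Identity : Set where
  constructor _≈_
  field
    lhs rhs : Term

module _ (A : Algebra c ℓ) where
  private module A = Algebra A

  ⟦_⟧ : Term → (ℕ → A.Carrier) → A.Carrier
  ⟦ var n ⟧ ρ = ρ n
  ⟦ s ∧ t ⟧ ρ = ⟦ s ⟧ ρ A.∧ ⟦ t ⟧ ρ
  ⟦ t ′ ⟧   ρ = (⟦ t ⟧ ρ) A.′

infix 3 _⊨_

_⊨_ : Algebra c ℓ → Identity → Set (c ⊔ ℓ)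
A ⊨ s ≈ t = ∀ ρ → Algebra._≈_ A (⟦ A ⟧ s ρ) (⟦ A ⟧ t ρ)

-- The class of ⟨∧,′⟩-reducts of Boolean algebras.
BA : Algebra c ℓ → Set (c ⊔ ℓ)
BA A = ∃[ ∨ ] ∃[ ⊤ ] ∃[ ⊥ ] IsBooleanAlgebra A._≈_ ∨ A._∧_ A._′ ⊤ ⊥
  where module A = Algebra A

Defines : ∀ {n} → Vector Identity n → (Algebra c ℓ → Set v) → Set (suc (c ⊔ ℓ) ⊔ v)
Defines E V = ∀ A → V A ⇔ (∀ i → A ⊨ E i)

-- "Follows" is semantic consequence over all algebras at the given levels.
-- A family with a repeated identity is never independent, so an independent
-- family indexed by Fin n is a set of exactly n identities.
Independent : ∀ c ℓ {n} → Vector Identity n → Set (suc (c ⊔ ℓ))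
Independent c ℓ E =
  ∀ i → ¬ (∀ (A : Algebra c ℓ) → (∀ j → j ≢ i → A ⊨ E j) → A ⊨ E i)

IsBase : ∀ n → Vector Identity n → (Algebra c ℓ → Set v) → Set (suc (c ⊔ ℓ) ⊔ v)
IsBase {c} {ℓ} n E V = Defines E V × Independent c ℓ E

private
  x y z : Term
  x = var 0
  y = var 1
  z = var 2

A6 : Identity
A6 = x ∧ (y ∧ z) ≈ y ∧ (z ∧ x)

J5′ : Identity
J5′ = x ≈ (x ′ ∧ y) ′ ∧ (x ′ ∧ y ′) ′

{-# OPTIONS --safe #-}

-- Up to duality, J5′ is Huntington's equation, so once ∧ is commutative and
-- associative, Huntington's argument produces a Boolean algebra with join
-- (x ′ ∧ y ′) ′. J5′ also makes every element a product, while A6 alone proves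
-- (a ∧ b) ∧ (c ∧ (d ∧ (e ∧ f))) ≈ (c ∧ (d ∧ (e ∧ f))) ∧ (a ∧ b); hence ∧ is
-- commutative, and A6 then turns into associativity. Independence is witnessed
-- by two algebras on the booleans: the left projection with an involution, and
-- a constant operation with the identity map.
module Submission where

open import Defs hiding (_≈_; _∧_; _′)
open import Level using (Level; Lift; lift; lower)
open import Data.Vec.Functional using ([]; _∷_)
open import Algebra.Bundles using (CommutativeSemigroup)
open import Algebra.Core using (Op₁; Op₂)
open import Algebra.Lattice.Bundles using (BooleanAlgebra)
open import Algebra.Lattice.Structures using (IsBooleanAlgebra; IsLattice)
open import Algebra.Lattice.Structures.Biased using (isBooleanAlgebraʳ; isDistributiveLatticeʳʲᵐ)
import Algebra.Consequences.Setoid as Consequences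
import Algebra.Lattice.Properties.BooleanAlgebra as BooleanAlgebraProperties
import Algebra.Properties.CommutativeSemigroup as CommutativeSemigroupProperties
open import Data.Bool using (Bool; true; false; not)
open import Data.Bool.Properties using (not-involutive)
open import Data.Empty using (⊥-elim)
open import Data.Fin using (zero; suc)
open import Data.Nat using (ℕ)
open import Data.Product using (_,_; ∃₂)
open import Function using (case_of_; const; id)
open import Function.Bundles using (mk⇔)
open import Relation.Binary.Bundles using (Setoid)
open import Relation.Binary.PropositionalEquality using (_≡_; _≢_; refl; sym; trans; cong; cong₂)
import Relation.Binary.Reasoning.Setoid as SetoidReasoning

private
  variable
    c ℓ : Level

module Huntington (A : Algebra c ℓ)
  (A⊨A6 : A ⊨ A6) (A⊨J5′ : A ⊨ J5′) where

  open Algebra A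

  private
    env : Carrier → Carrier → Carrier → ℕ → Carrier
    env x y z 0 = x
    env x y z 1 = y
    env x y z _ = z

  cyclic : ∀ x y z → x ∧ (y ∧ z) ≈ y ∧ (z ∧ x)
  cyclic x y z = A⊨A6 (env x y z)

  huntington : ∀ x y → x ≈ (x ′ ∧ y) ′ ∧ (x ′ ∧ y ′) ′
  huntington x y = A⊨J5′ (env x y y)

  setoid : Setoid c ℓ
  setoid = record { isEquivalence = isEquivalence }

  open Setoid setoid using () renaming (refl to ≈-refl; sym to ≈-sym; trans to ≈-trans)
  open SetoidReasoning setoid

  ∧-congˡ : ∀ {x y z} → y ≈ z → x ∧ y ≈ x ∧ z
  ∧-congˡ = ∧-cong ≈-refl

  ∧-congʳ : ∀ {x y z} → y ≈ z → y ∧ x ≈ z ∧ x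
  ∧-congʳ y≈z = ∧-cong y≈z ≈-refl

  -- Commutativity and associativity of the meet.

  cyclic⁻ : ∀ x y z → x ∧ (y ∧ z) ≈ z ∧ (x ∧ y)
  cyclic⁻ x y z = ≈-sym (cyclic z x y)

  -- Each step rotates three blocks of a product `x ∧ (y ∧ z)`. A block may itself be a product, so
  -- rotations at different depths change the bracketing as well as the order.
  products-commute : ∀ a b c d e f →
    (a ∧ b) ∧ (c ∧ (d ∧ (e ∧ f))) ≈ (c ∧ (d ∧ (e ∧ f))) ∧ (a ∧ b)
  products-commute a b c d e f = begin
    (a ∧ b) ∧ (c ∧ (d ∧ (e ∧ f)))  ≈⟨ ∧-congˡ (cyclic⁻ c d (e ∧ f)) ⟩
    (a ∧ b) ∧ ((e ∧ f) ∧ (c ∧ d))  ≈⟨ cyclic⁻ (a ∧ b) (e ∧ f) (c ∧ d) ⟩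
    (c ∧ d) ∧ ((a ∧ b) ∧ (e ∧ f))  ≈⟨ ∧-congˡ (cyclic (a ∧ b) e f) ⟩
    -- This rotation breaks the pair `a ∧ b`, leaving `b` grouped with `f`; the pair is rejoined by
    -- `cyclic⁻ a b` below.
    (c ∧ d) ∧ (e ∧ (f ∧ (a ∧ b)))  ≈⟨ ∧-congˡ (∧-congˡ (cyclic f a b)) ⟩
    (c ∧ d) ∧ (e ∧ (a ∧ (b ∧ f)))  ≈⟨ ∧-congˡ (cyclic⁻ e a (b ∧ f)) ⟩
    (c ∧ d) ∧ ((b ∧ f) ∧ (e ∧ a))  ≈⟨ cyclic (c ∧ d) (b ∧ f) (e ∧ a) ⟩
    (b ∧ f) ∧ ((e ∧ a) ∧ (c ∧ d))  ≈⟨ ∧-congˡ (cyclic (e ∧ a) c d) ⟩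
    (b ∧ f) ∧ (c ∧ (d ∧ (e ∧ a)))  ≈⟨ ∧-congˡ (∧-congˡ (cyclic⁻ d e a)) ⟩
    (b ∧ f) ∧ (c ∧ (a ∧ (d ∧ e)))  ≈⟨ ∧-congˡ (cyclic c a (d ∧ e)) ⟩
    (b ∧ f) ∧ (a ∧ ((d ∧ e) ∧ c))  ≈⟨ cyclic (b ∧ f) a ((d ∧ e) ∧ c) ⟩
    a ∧ (((d ∧ e) ∧ c) ∧ (b ∧ f))  ≈⟨ ∧-congˡ (cyclic ((d ∧ e) ∧ c) b f) ⟩
    a ∧ (b ∧ (f ∧ ((d ∧ e) ∧ c)))  ≈⟨ cyclic⁻ a b (f ∧ ((d ∧ e) ∧ c)) ⟩
    (f ∧ ((d ∧ e) ∧ c)) ∧ (a ∧ b)  ≈⟨ ∧-congʳ (cyclic⁻ f (d ∧ e) c) ⟩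
    (c ∧ (f ∧ (d ∧ e))) ∧ (a ∧ b)  ≈⟨ ∧-congʳ (∧-congˡ (cyclic f d e)) ⟩
    (c ∧ (d ∧ (e ∧ f))) ∧ (a ∧ b)  ∎

  factor : ∀ x → ∃₂ λ a b → x ≈ a ∧ b
  -- The second variable of J5′ is free; `x` is an arbitrary choice.
  factor x = (x ′ ∧ x) ′ , (x ′ ∧ x ′) ′ , huntington x x

  -- Factoring `x` once, and `y` three times along its right factor, brings both into the shapes
  -- required by `products-commute`.
  ∧-comm : ∀ x y → x ∧ y ≈ y ∧ x
  ∧-comm x y
    with a , b , x≈ab ← factor x
       | c , u , y≈cu ← factor y
    with d , v , u≈dv ← factor u
    with e , f , v≈ef ← factor v
    = begin
    x ∧ y                          ≈⟨ ∧-cong x≈ab y≈cdef ⟩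
    (a ∧ b) ∧ (c ∧ (d ∧ (e ∧ f)))  ≈⟨ products-commute a b c d e f ⟩
    (c ∧ (d ∧ (e ∧ f))) ∧ (a ∧ b)  ≈⟨ ∧-cong y≈cdef x≈ab ⟨
    y ∧ x                          ∎
    where
    y≈cdef : y ≈ c ∧ (d ∧ (e ∧ f))
    y≈cdef = ≈-trans y≈cu (∧-congˡ (≈-trans u≈dv (∧-congˡ v≈ef)))

  ∧-assoc : ∀ x y z → (x ∧ y) ∧ z ≈ x ∧ (y ∧ z)
  ∧-assoc x y z = ≈-trans (∧-comm (x ∧ y) z) (cyclic z x y)

  ∧-commutativeSemigroup : CommutativeSemigroup c ℓ
  ∧-commutativeSemigroup = record
    { isCommutativeSemigroup = record
      { isSemigroup = record
        { isMagma = record { isEquivalence = isEquivalence ; ∙-cong = ∧-cong }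
        ; assoc   = ∧-assoc
        }
      ; comm = ∧-comm
      }
    }

  -- Complements.

  open CommutativeSemigroupProperties ∧-commutativeSemigroup
    using (interchange; x∙yz≈y∙xz)

  -- Expanding `x` and `x ′` along `y ′` gives the meet of the four joins of `x` or `x ′` with `y`
  -- or `y ′`, which is symmetric in `x` and `y`.
  x∧x′≈y∧y′ : ∀ x y → x ∧ x ′ ≈ y ∧ y ′
  x∧x′≈y∧y′ x y = begin
    x ∧ x ′
      ≈⟨ ∧-cong (huntington x (y ′)) (huntington (x ′) (y ′)) ⟩
    ((x ′ ∧ y ′) ′ ∧ (x ′ ∧ y ′ ′) ′) ∧ ((x ′ ′ ∧ y ′) ′ ∧ (x ′ ′ ∧ y ′ ′) ′)
      ≈⟨ interchange _ _ _ _ ⟩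
    ((x ′ ∧ y ′) ′ ∧ (x ′ ′ ∧ y ′) ′) ∧ ((x ′ ∧ y ′ ′) ′ ∧ (x ′ ′ ∧ y ′ ′) ′)
      ≈⟨ ∧-cong (∧-cong (′-cong (∧-comm _ _)) (′-cong (∧-comm _ _)))
                (∧-cong (′-cong (∧-comm _ _)) (′-cong (∧-comm _ _))) ⟩
    ((y ′ ∧ x ′) ′ ∧ (y ′ ∧ x ′ ′) ′) ∧ ((y ′ ′ ∧ x ′) ′ ∧ (y ′ ′ ∧ x ′ ′) ′)
      ≈⟨ ∧-cong (huntington y (x ′)) (huntington (y ′) (x ′)) ⟨
    y ∧ y ′  ∎

  -- The expansion of `x ′ ′` along `x ′` and that of `x` along `x ′ ′` have the same factors: one
  -- pair agrees by commutativity, the other by `x∧x′≈y∧y′`.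
  ′-involutive : ∀ x → x ′ ′ ≈ x
  ′-involutive x = begin
    x ′ ′                                ≈⟨ huntington (x ′ ′) (x ′) ⟩
    (x ′ ′ ′ ∧ x ′) ′ ∧ (x ′ ′ ′ ∧ x ′ ′) ′  ≈⟨ ∧-comm _ _ ⟩
    (x ′ ′ ′ ∧ x ′ ′) ′ ∧ (x ′ ′ ′ ∧ x ′) ′
      ≈⟨ ∧-cong (′-cong (≈-trans (∧-comm _ _) (x∧x′≈y∧y′ (x ′ ′) (x ′)))) (′-cong (∧-comm _ _)) ⟩
    (x ′ ∧ x ′ ′) ′ ∧ (x ′ ∧ x ′ ′ ′) ′      ≈⟨ huntington x (x ′ ′) ⟨
    x                                    ∎

  -- Bounds, idempotence and absorption.

  infixr 6 _∨_
  _∨_ : Op₂ Carrier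
  x ∨ y = (x ′ ∧ y ′) ′

  -- Nonemptiness supplies the element; by `x∧x′≈y∧y′` the value does not depend on which one is
  -- taken.
  ⊥ ⊤ : Carrier
  ⊥ = inhabitant ∧ inhabitant ′
  ⊤ = ⊥ ′

  ∧-complementʳ : ∀ x → x ∧ x ′ ≈ ⊥
  ∧-complementʳ x = x∧x′≈y∧y′ x inhabitant

  -- Equating the variables of J5′ turns one factor into `⊤`. In terms of the join this is
  -- `x ≈ (x ∨ x) ∧ ⊤`, the source of both the identity law and idempotence.
  x≈[x′∧x′]′∧⊤ : ∀ x → x ≈ (x ′ ∧ x ′) ′ ∧ ⊤
  x≈[x′∧x′]′∧⊤ x = begin
    x                                ≈⟨ huntington x x ⟩
    (x ′ ∧ x) ′ ∧ (x ′ ∧ x ′) ′      ≈⟨ ∧-comm _ _ ⟩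
    (x ′ ∧ x ′) ′ ∧ (x ′ ∧ x) ′      ≈⟨ ∧-congˡ (′-cong (≈-trans (∧-comm _ _) (∧-complementʳ x))) ⟩
    (x ′ ∧ x ′) ′ ∧ ⊤                ∎

  -- Once `⊥ ≈ ⊥ ∧ (⊥ ∧ ⊥) ′`, the element `⊥ ∧ ⊥` equals its meet with its own complement. That
  -- equation comes from writing `⊤` as `(⊥ ∧ ⊥) ′ ∧ ⊤` inside `⊥ ∧ ⊤ ≈ ⊥`.
  ⊥∧⊥≈⊥ : ⊥ ∧ ⊥ ≈ ⊥
  ⊥∧⊥≈⊥ = begin
    ⊥ ∧ ⊥                  ≈⟨ ∧-congʳ ⊥≈⊥∧[⊥∧⊥]′ ⟩
    (⊥ ∧ (⊥ ∧ ⊥) ′) ∧ ⊥    ≈⟨ ∧-comm _ _ ⟩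
    ⊥ ∧ (⊥ ∧ (⊥ ∧ ⊥) ′)    ≈⟨ ∧-assoc _ _ _ ⟨
    (⊥ ∧ ⊥) ∧ (⊥ ∧ ⊥) ′    ≈⟨ ∧-complementʳ (⊥ ∧ ⊥) ⟩
    ⊥                      ∎
    where
    ⊥≈⊥∧[⊥∧⊥]′ : ⊥ ≈ ⊥ ∧ (⊥ ∧ ⊥) ′
    ⊥≈⊥∧[⊥∧⊥]′ = begin
      ⊥                          ≈⟨ ∧-complementʳ ⊥ ⟨
      ⊥ ∧ ⊤                      ≈⟨ ∧-congˡ (x≈[x′∧x′]′∧⊤ ⊤) ⟩
      ⊥ ∧ ((⊤ ′ ∧ ⊤ ′) ′ ∧ ⊤)    ≈⟨ ∧-congˡ (∧-congʳ (′-cong (∧-cong (′-involutive ⊥) (′-involutive ⊥)))) ⟩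
      ⊥ ∧ ((⊥ ∧ ⊥) ′ ∧ ⊤)        ≈⟨ x∙yz≈y∙xz _ _ _ ⟩
      (⊥ ∧ ⊥) ′ ∧ (⊥ ∧ ⊤)        ≈⟨ ∧-congˡ (∧-complementʳ ⊥) ⟩
      (⊥ ∧ ⊥) ′ ∧ ⊥              ≈⟨ ∧-comm _ _ ⟩
      ⊥ ∧ (⊥ ∧ ⊥) ′              ∎

  ⊤∧⊤≈⊤ : ⊤ ∧ ⊤ ≈ ⊤
  ⊤∧⊤≈⊤ = begin
    ⊤ ∧ ⊤                  ≈⟨ ∧-congʳ (′-cong (≈-trans (∧-cong (′-involutive ⊥) (′-involutive ⊥)) ⊥∧⊥≈⊥)) ⟨
    (⊤ ′ ∧ ⊤ ′) ′ ∧ ⊤      ≈⟨ x≈[x′∧x′]′∧⊤ ⊤ ⟨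
    ⊤                      ∎

  -- Every element already has a factor `⊤`, and a second one merges with it.
  ∧-identityʳ : ∀ x → x ∧ ⊤ ≈ x
  ∧-identityʳ x = begin
    x ∧ ⊤                      ≈⟨ ∧-congʳ (x≈[x′∧x′]′∧⊤ x) ⟩
    ((x ′ ∧ x ′) ′ ∧ ⊤) ∧ ⊤    ≈⟨ ∧-assoc _ _ _ ⟩
    (x ′ ∧ x ′) ′ ∧ (⊤ ∧ ⊤)    ≈⟨ ∧-congˡ ⊤∧⊤≈⊤ ⟩
    (x ′ ∧ x ′) ′ ∧ ⊤          ≈⟨ x≈[x′∧x′]′∧⊤ x ⟨
    x                          ∎

  ∨-idem : ∀ x → x ∨ x ≈ x
  ∨-idem x = ≈-trans (≈-sym (∧-identityʳ _)) (≈-sym (x≈[x′∧x′]′∧⊤ x))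

  ∧-idem : ∀ x → x ∧ x ≈ x
  ∧-idem x = begin
    x ∧ x              ≈⟨ ′-involutive (x ∧ x) ⟨
    (x ∧ x) ′ ′        ≈⟨ ′-cong (′-cong (∧-cong (′-involutive x) (′-involutive x))) ⟨
    (x ′ ∨ x ′) ′      ≈⟨ ′-cong (∨-idem (x ′)) ⟩
    x ′ ′              ≈⟨ ′-involutive x ⟩
    x                  ∎

  -- By J5′, `(x ′ ∧ y) ′` is a factor of `x`, so idempotence removes the second copy. Both
  -- absorption laws follow, up to double complements.
  x∧[x′∧y]′≈x : ∀ x y → x ∧ (x ′ ∧ y) ′ ≈ x
  x∧[x′∧y]′≈x x y = begin
    x ∧ (x ′ ∧ y) ′                                ≈⟨ ∧-congʳ (huntington x y) ⟩
    ((x ′ ∧ y) ′ ∧ (x ′ ∧ y ′) ′) ∧ (x ′ ∧ y) ′    ≈⟨ ∧-comm _ _ ⟩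
    (x ′ ∧ y) ′ ∧ ((x ′ ∧ y) ′ ∧ (x ′ ∧ y ′) ′)    ≈⟨ ∧-assoc _ _ _ ⟨
    ((x ′ ∧ y) ′ ∧ (x ′ ∧ y) ′) ∧ (x ′ ∧ y ′) ′    ≈⟨ ∧-congʳ (∧-idem _) ⟩
    (x ′ ∧ y) ′ ∧ (x ′ ∧ y ′) ′                    ≈⟨ huntington x y ⟨
    x                                              ∎

  ∧-absorbs-∨ : ∀ x y → x ∧ (x ∨ y) ≈ x
  ∧-absorbs-∨ x y = x∧[x′∧y]′≈x x (y ′)

  ∨-absorbs-∧ : ∀ x y → x ∨ (x ∧ y) ≈ x
  ∨-absorbs-∧ x y = begin
    (x ′ ∧ (x ∧ y) ′) ′        ≈⟨ ′-cong (∧-congˡ (′-cong (∧-congʳ (′-involutive x)))) ⟨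
    (x ′ ∧ (x ′ ′ ∧ y) ′) ′    ≈⟨ ′-cong (x∧[x′∧y]′≈x (x ′) y) ⟩
    x ′ ′                      ≈⟨ ′-involutive x ⟩
    x                          ∎

  -- Laws of the join and distributivity.

  ∨-cong : ∀ {x y u v} → x ≈ y → u ≈ v → x ∨ u ≈ y ∨ v
  ∨-cong x≈y u≈v = ′-cong (∧-cong (′-cong x≈y) (′-cong u≈v))

  ∨-congˡ : ∀ {x y z} → y ≈ z → x ∨ y ≈ x ∨ z
  ∨-congˡ = ∨-cong ≈-refl

  ∨-comm : ∀ x y → x ∨ y ≈ y ∨ x
  ∨-comm x y = ′-cong (∧-comm (x ′) (y ′))

  ∨-assoc : ∀ x y z → (x ∨ y) ∨ z ≈ x ∨ (y ∨ z)
  ∨-assoc x y z = ′-cong (begin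
    (x ′ ∧ y ′) ′ ′ ∧ z ′    ≈⟨ ∧-congʳ (′-involutive _) ⟩
    (x ′ ∧ y ′) ∧ z ′        ≈⟨ ∧-assoc _ _ _ ⟩
    x ′ ∧ (y ′ ∧ z ′)        ≈⟨ ∧-congˡ (′-involutive _) ⟨
    x ′ ∧ (y ′ ∧ z ′) ′ ′    ∎)

  ∨-complementʳ : ∀ x → x ∨ x ′ ≈ ⊤
  ∨-complementʳ x = ′-cong (∧-complementʳ (x ′))

  ∨-zeroʳ : ∀ x → x ∨ ⊤ ≈ ⊤
  ∨-zeroʳ x = begin
    x ∨ ⊤            ≈⟨ ∨-congˡ (∨-complementʳ x) ⟨
    x ∨ (x ∨ x ′)    ≈⟨ ∨-assoc _ _ _ ⟨
    (x ∨ x) ∨ x ′    ≈⟨ ∨-cong (∨-idem x) ≈-refl ⟩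
    x ∨ x ′          ≈⟨ ∨-complementʳ x ⟩
    ⊤                ∎

  deMorgan : ∀ x y → x ′ ∨ y ′ ≈ (x ∧ y) ′
  deMorgan x y = ′-cong (∧-cong (′-involutive x) (′-involutive y))

  -- Taking J5′ at `y ′` makes both factors joins by definition, with no double complement to
  -- remove.
  split : ∀ x y → x ≈ (x ∨ y) ∧ (x ∨ y ′)
  split x y = huntington x (y ′)

  -- Both sides are reduced to (x ∨ y) ∧ ((x ∨ z) ∨ y ′) by splitting with
  -- respect to y and z.
  ∨-distribˡ-∧ : ∀ x y z → x ∨ (y ∧ z) ≈ (x ∨ y) ∧ (x ∨ z)
  ∨-distribˡ-∧ x y z = begin
    w                                               ≈⟨ split w y ⟩
    (w ∨ y) ∧ (w ∨ y ′)                             ≈⟨ ∧-cong w∨y≈x∨y (split (w ∨ y ′) z) ⟩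
    -- The `z ′` half is `⊤`, because `y ′ ∨ z ′` is the complement of the joinand `y ∧ z` of `w`.
    (x ∨ y) ∧ (((w ∨ y ′) ∨ z) ∧ ((w ∨ y ′) ∨ z ′)) ≈⟨ ∧-congˡ (∧-cong w∨y′∨z≈x∨z∨y′ w∨y′∨z′≈⊤) ⟩
    (x ∨ y) ∧ (((x ∨ z) ∨ y ′) ∧ ⊤)                 ≈⟨ ∧-congˡ (∧-identityʳ _) ⟩
    -- Absorption inserts `(x ∨ y) ∨ z`, the missing half of the split of `x ∨ z` along `y`.
    (x ∨ y) ∧ ((x ∨ z) ∨ y ′)                       ≈⟨ ∧-congʳ (∧-absorbs-∨ (x ∨ y) z) ⟨
    ((x ∨ y) ∧ ((x ∨ y) ∨ z)) ∧ ((x ∨ z) ∨ y ′)     ≈⟨ ∧-congʳ (∧-congˡ (swap x y z)) ⟩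
    ((x ∨ y) ∧ ((x ∨ z) ∨ y)) ∧ ((x ∨ z) ∨ y ′)     ≈⟨ ∧-assoc _ _ _ ⟩
    (x ∨ y) ∧ (((x ∨ z) ∨ y) ∧ ((x ∨ z) ∨ y ′))     ≈⟨ ∧-congˡ (split (x ∨ z) y) ⟨
    (x ∨ y) ∧ (x ∨ z)                               ∎
    where
    w = x ∨ (y ∧ z)

    swap : ∀ a b c → (a ∨ b) ∨ c ≈ (a ∨ c) ∨ b
    swap a b c = begin
      (a ∨ b) ∨ c  ≈⟨ ∨-assoc _ _ _ ⟩
      a ∨ (b ∨ c)  ≈⟨ ∨-congˡ (∨-comm b c) ⟩
      a ∨ (c ∨ b)  ≈⟨ ∨-assoc _ _ _ ⟨
      (a ∨ c) ∨ b  ∎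

    w∨y≈x∨y : w ∨ y ≈ x ∨ y
    w∨y≈x∨y = begin
      (x ∨ (y ∧ z)) ∨ y    ≈⟨ ∨-assoc _ _ _ ⟩
      x ∨ ((y ∧ z) ∨ y)    ≈⟨ ∨-congˡ (∨-comm _ _) ⟩
      x ∨ (y ∨ (y ∧ z))    ≈⟨ ∨-congˡ (∨-absorbs-∧ y z) ⟩
      x ∨ y                ∎

    w∨y′∨z≈x∨z∨y′ : (w ∨ y ′) ∨ z ≈ (x ∨ z) ∨ y ′
    w∨y′∨z≈x∨z∨y′ = begin
      (w ∨ y ′) ∨ z                ≈⟨ swap w (y ′) z ⟩
      ((x ∨ (y ∧ z)) ∨ z) ∨ y ′    ≈⟨ ∨-cong (∨-assoc _ _ _) ≈-refl ⟩
      (x ∨ ((y ∧ z) ∨ z)) ∨ y ′    ≈⟨ ∨-cong (∨-congˡ (∨-comm _ _)) ≈-refl ⟩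
      (x ∨ (z ∨ (y ∧ z))) ∨ y ′    ≈⟨ ∨-cong (∨-congˡ (∨-congˡ (∧-comm y z))) ≈-refl ⟩
      (x ∨ (z ∨ (z ∧ y))) ∨ y ′    ≈⟨ ∨-cong (∨-congˡ (∨-absorbs-∧ z y)) ≈-refl ⟩
      (x ∨ z) ∨ y ′                ∎

    w∨y′∨z′≈⊤ : (w ∨ y ′) ∨ z ′ ≈ ⊤
    w∨y′∨z′≈⊤ = begin
      (w ∨ y ′) ∨ z ′                ≈⟨ ∨-assoc _ _ _ ⟩
      w ∨ (y ′ ∨ z ′)                ≈⟨ ∨-congˡ (deMorgan y z) ⟩
      (x ∨ (y ∧ z)) ∨ (y ∧ z) ′      ≈⟨ ∨-assoc _ _ _ ⟩
      x ∨ ((y ∧ z) ∨ (y ∧ z) ′)      ≈⟨ ∨-congˡ (∨-complementʳ (y ∧ z)) ⟩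
      x ∨ ⊤                          ≈⟨ ∨-zeroʳ x ⟩
      ⊤                              ∎

  isLattice : IsLattice _≈_ _∨_ _∧_
  isLattice = record
    { isEquivalence = isEquivalence
    ; ∨-comm        = ∨-comm
    ; ∨-assoc       = ∨-assoc
    ; ∨-cong        = ∨-cong
    ; ∧-comm        = ∧-comm
    ; ∧-assoc       = ∧-assoc
    ; ∧-cong        = ∧-cong
    ; absorptive    = ∨-absorbs-∧ , ∧-absorbs-∨
    }

  isBooleanAlgebra : IsBooleanAlgebra _≈_ _∨_ _∧_ _′ ⊤ ⊥
  isBooleanAlgebra = isBooleanAlgebraʳ (record
    { isDistributiveLattice = isDistributiveLatticeʳʲᵐ (record
      { isLattice    = isLattice
      ; ∨-distribʳ-∧ = Consequences.comm∧distrˡ⇒distrʳ setoid ∧-cong ∨-comm ∨-distribˡ-∧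
      })
    ; ∨-complementʳ = ∨-complementʳ
    ; ∧-complementʳ = ∧-complementʳ
    ; ¬-cong        = ′-cong
    })

-- Validity of the identities in Boolean algebras.

module _ (B : BooleanAlgebra c ℓ) where
  open BooleanAlgebra B renaming (refl to ≈-refl; trans to ≈-trans)
  open BooleanAlgebraProperties B
  open SetoidReasoning setoid

  ∧-cyclic : ∀ x y z → x ∧ (y ∧ z) ≈ y ∧ (z ∧ x)
  ∧-cyclic x y z = ≈-trans (∧-comm x (y ∧ z)) (∧-assoc y z x)

  -- By De Morgan the right-hand side is `(x ∨ ¬ y) ∧ (x ∨ y)`, which distributivity collapses to
  -- `x ∨ (¬ y ∧ y)`.
  ¬-huntington : ∀ x y → x ≈ ¬ (¬ x ∧ y) ∧ ¬ (¬ x ∧ ¬ y)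
  ¬-huntington x y = begin
    x                                      ≈⟨ ∨-identityʳ x ⟨
    x ∨ ⊥                                  ≈⟨ ∨-congˡ (∧-complementˡ y) ⟨
    x ∨ (¬ y ∧ y)                          ≈⟨ ∨-distribˡ-∧ x (¬ y) y ⟩
    (x ∨ ¬ y) ∧ (x ∨ y)                    ≈⟨ ∧-cong (¬[¬∧] x y) (≈-trans (¬[¬∧] x (¬ y)) (∨-congˡ (¬-involutive y))) ⟨
    ¬ (¬ x ∧ y) ∧ ¬ (¬ x ∧ ¬ y)            ∎
    where
    ¬[¬∧] : ∀ x y → ¬ (¬ x ∧ y) ≈ x ∨ ¬ y
    ¬[¬∧] x y = ≈-trans (deMorgan₁ (¬ x) y) (∨-congʳ (¬-involutive x))

-- `Lift` carries the two-element models to every pair of levels, since independence is asserted at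
-- each of them.
boolAlgebra : ∀ c ℓ → Op₂ Bool → Op₁ Bool → Algebra c ℓ
boolAlgebra c ℓ _∙_ _* = record
  { Carrier       = Lift c Bool
  ; _≈_           = λ x y → Lift ℓ (lower x ≡ lower y)
  ; _∧_           = λ x y → lift (lower x ∙ lower y)
  ; _′            = λ x → lift (lower x *)
  ; inhabitant    = lift true
  ; isEquivalence = record
    { refl  = lift refl
    ; sym   = λ p → lift (sym (lower p))
    ; trans = λ p q → lift (trans (lower p) (lower q))
    }
  ; ∧-cong        = λ p q → lift (cong₂ _∙_ (lower p) (lower q))
  ; ′-cong        = λ p → lift (cong _* (lower p))
  }

-- Axiomatization and independence.

base-defines-BA : Defines (A6 ∷ J5′ ∷ []) (BA {c} {ℓ})
base-defines-BA A = mk⇔ sound complete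
  where
  sound : BA A → ∀ i → A ⊨ (A6 ∷ J5′ ∷ []) i
  sound (_ , _ , _ , isBA) = λ where
      zero       ρ → ∧-cyclic B (ρ 0) (ρ 1) (ρ 2)
      (suc zero) ρ → ¬-huntington B (ρ 0) (ρ 1)
    where
    B : BooleanAlgebra _ _
    B = record { isBooleanAlgebra = isBA }

  complete : (∀ i → A ⊨ (A6 ∷ J5′ ∷ []) i) → BA A
  complete A⊨E = _ , _ , _ , Huntington.isBooleanAlgebra A (A⊨E zero) (A⊨E (suc zero))

base-independent : ∀ c ℓ → Independent c ℓ (A6 ∷ J5′ ∷ [])
base-independent c ℓ zero J5′⇒A6 =
  -- Under the left projection A6 reads `x ≈ y`, while the right-hand side of J5′ reduces to
  -- `x ′ ′`.
  case lower (J5′⇒A6 (boolAlgebra c ℓ const not) ⊨others ρ) of λ ()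
  where
  ⊨others : ∀ j → j ≢ zero → boolAlgebra c ℓ const not ⊨ (A6 ∷ J5′ ∷ []) j
  ⊨others zero       j≢i = ⊥-elim (j≢i refl)
  ⊨others (suc zero) _ ρ = lift (sym (not-involutive _))

  ρ : ℕ → Lift c Bool
  ρ 0 = lift true
  ρ _ = lift false
base-independent c ℓ (suc zero) A6⇒J5′ =
  -- With the constant meet both sides of A6 are `false`, while J5′ reads `x ≈ false` and fails at
  -- `true`.
  case lower (A6⇒J5′ (boolAlgebra c ℓ (λ _ _ → false) id) ⊨others λ _ → lift true) of λ ()
  where
  ⊨others : ∀ j → j ≢ suc zero → boolAlgebra c ℓ (λ _ _ → false) id ⊨ (A6 ∷ J5′ ∷ []) j
  ⊨others zero       _ _ = lift refl
  ⊨others (suc zero) j≢i = ⊥-elim (j≢i refl)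

theorem4p1 : ∀ (c ℓ : Level) → IsBase 2 (A6 ∷ J5′ ∷ []) (BA {c} {ℓ})
theorem4p1 c ℓ = base-defines-BA , base-independent c ℓ
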